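{- Let $c\ge 1$ and $n_1\ge n_2\ge\cdots\ge n_c\ge 1$ be integers, and let $N=n_1+1+\sum_{i=1}^{c}(n_i-1)$. Then the star-critical Ramsey number satisfies $r_*(n_1K_2,n_2K_2,\ldots,n_cK_2)=\sum_{i=2}^{c}(n_i-1)+1$; that is, the smallest positive integer $k$ such that every $c$-edge-coloring of $K_{N-1}\sqcup K_{1,k}$ contains, for some $i\in\{1,\ldots,c\}$, a matching of $n_i$ edges all of color $i$, equals $\sum_{i=2}^{c}(n_i-1)+1$.
   Context: $n_iK_2$ denotes a matching of $n_i$ pairwise vertex-disjoint edges. For integers $m\ge 2$ and $k$, $K_{m-1}\sqcup K_{1,k}$ denotes the graph obtained from the complete graph $K_{m-1}$ by adding a new vertex $v$ and joining $v$ to $k$ vertices of $K_{m-1}$. The number $N=n_1+1+\sum_{i=1}^{c}(n_i-1)$ is the Ramsey number $r(n_1K_2,\ldots,n_cK_2)$, i.e., the smallest $n$ such that every $c$-edge-colored $K_n$ contains a matching of $n_i$ edges of color $i$ for some $i$. For $H_1,\ldots,H_c$ with $n=r(H_1,\ldots,H_c)$, the star-critical Ramsey number $r_*(H_1,\ldots,H_c)$ is the smallest positive integer $k$ such that every $c$-edge-coloring of $K_{n-1}\sqcup K_{1,k}$ contains a subgraph isomorphic to $H_i$ in color $i$ for some $i$. -}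

module Defs where

open import Data.Nat using (ℕ; zero; suc; _+_; _∸_; _<_; _≤_)
open import Data.Fin as F using (Fin; toℕ)
open import Data.List using (List; map; allFin)
open import Data.Nat.ListAction using (sum)
open import Data.Product using (_×_; _,_; proj₁; proj₂; ∃)
open import Relation.Binary.PropositionalEquality using (_≡_; _≢_)
open import Relation.Nullary using (¬_)

tailSum : ∀ {d} → (Fin (suc d) → ℕ) → ℕ
tailSum {d} n = sum (map (λ j → n (F.suc j) ∸ 1) (allFin d))

Nm1 : ∀ {d} → (Fin (suc d) → ℕ) → ℕ
Nm1 n = n F.zero + ((n F.zero ∸ 1) + tailSum n)

-- The graph K_M ⊔ K_{1,k} on vertex set Fin (suc M):
-- vertex F.zero is the new vertex v, vertex F.suc a is vertex a of K_M;
-- v is joined to the k vertices a of K_M with toℕ a < k.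
Adj : (M k : ℕ) → Fin (suc M) → Fin (suc M) → Set
Adj M k F.zero F.zero = ¬ (0 ≡ 0)
Adj M k F.zero (F.suc b) = toℕ b < k
Adj M k (F.suc a) F.zero = toℕ a < k
Adj M k (F.suc a) (F.suc b) = a ≢ b

-- Edge-colourings with c colours: symmetric colour functions on vertex pairs
-- (only the values on edges of the graph matter).
Coloring : (c M : ℕ) → Set
Coloring c M = Fin (suc M) → Fin (suc M) → Fin c

Symmetric : ∀ {c M} → Coloring c M → Set
Symmetric col = ∀ u w → col u w ≡ col w u

record MonoMatching {c} (M k : ℕ) (col : Coloring c M) (i : Fin c) (m : ℕ) : Set where
  field
    edge     : Fin m → Fin (suc M) × Fin (suc M)
    isEdge   : ∀ p → Adj M k (proj₁ (edge p)) (proj₂ (edge p))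
    colour   : ∀ p → col (proj₁ (edge p)) (proj₂ (edge p)) ≡ i
    disjoint : ∀ p q → p ≢ q →
                 (proj₁ (edge p) ≢ proj₁ (edge q)) × (proj₁ (edge p) ≢ proj₂ (edge q)) ×
                 (proj₂ (edge p) ≢ proj₁ (edge q)) × (proj₂ (edge p) ≢ proj₂ (edge q))

Arrows : ∀ {d} → (Fin (suc d) → ℕ) → ℕ → Set
Arrows {d} n k = (col : Coloring (suc d) (Nm1 n)) → Symmetric col →
                 ∃ λ i → MonoMatching (Nm1 n) k col i (n i)

IsStarCritical : ∀ {d} → (Fin (suc d) → ℕ) → ℕ → Set
IsStarCritical n s = (1 ≤ s) × Arrows n s × (∀ k → 1 ≤ k → k < s → ¬ Arrows n k)

{-# OPTIONS --safe #-}

-- Upper bound.  Suppose colour i has no matching of more than m_i = n_i − 1 edges.  Deleting a vertex that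
-- lies in every maximum matching of some colour i, and lowering m_i by one, preserves all hypotheses, so
-- assume that every vertex is missed by a maximum matching in every colour.  Call x, y i-linked when no
-- maximum matching of colour i misses both; an edge of colour i links its ends, and by Gallai's lemma two
-- vertices with a common neighbour in colour i are i-linked.  Fix x ≠ v.  If every y ≠ v, x is linked to x
-- in two colours, then maximum matchings missing x, one for each colour, cover every such y twice.
-- Otherwise some y is linked to x only in the colour i₀ of xy: take matchings missing both x and y in the
-- other colours, and two in colour i₀, one missing x and one missing y; these cover every vertex other
-- than v, x, y twice.  Either way Σ m_i + max m_i is at least the number of vertices other than v, less
-- one, strictly so if x is a neighbour of v.  This contradicts the number of vertices if v is deleted or has a
-- neighbour x left; if v is isolated, at most 2n_1 − 1 vertices are left, so Σ m_i < n_1 − 1, again too small.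
--
-- Lower bound.  Partition the vertices into a set of 2n_1 − 1 vertices of K_{N−1} together with v, and blocks of
-- n_i − 1 vertices for i ≥ 2 that contain all neighbours of v, and colour each edge by its larger class.

module Submission where

open import Defs
open import Data.Bool using (if_then_else_)
open import Data.Empty using (⊥; ⊥-elim)
open import Data.Nat using (ℕ; zero; suc; _+_; _∸_; _≤_; _<_; z≤n; s≤s; s≤s⁻¹)
open import Data.Nat.Tactic.RingSolver using (solve-∀)
open import Data.Nat.Properties as ℕ hiding (_≟_; suc-injective; ⊔-sel; ⊔-comm)
open import Data.Fin as F using (Fin; zero; suc; toℕ; fromℕ<; splitAt; join)
open import Data.Fin.Properties as F using (_≟_; all?; any?; suc-injective; injective⇒≤; toℕ-fromℕ<)
import Data.List as List
import Data.Nat.ListAction as ListAction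
open import Data.List.Properties using (map-tabulate)
open import Data.Fin.Permutation using (permutation)
open import Data.Product using (∃; _×_; _,_; proj₁; proj₂; map₂; Σ-syntax; ∃-syntax)
open import Data.Sum using (_⊎_; inj₁; inj₂; [_,_]′; map₁)
open import Data.Unit using (⊤; tt)
open import Data.Vec.Functional using ([]; _∷_; head; tail)
open import Function using (_∘_)
open import Relation.Nullary using (Dec; yes; no; does; ¬_; contradiction)
open import Relation.Nullary.Decidable using (¬?; map′; _×-dec_; _→-dec_; decidable-stable)
open import Relation.Unary using (Decidable)
open import Relation.Binary.PropositionalEquality
open import Relation.Binary.Definitions using (tri<; tri≈; tri>)
open import Algebra.Properties.CommutativeMonoid.Sum ℕ.+-0-commutativeMonoid
  using (sum; sum-cong-≗; sum-replicate-zero; ∑-distrib-+; ∑-comm; sum-permute)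

private variable
  k l : ℕ

-- Indicator sums and finite search

ind : {A : Set} → Dec A → ℕ
ind d = if does d then 1 else 0

ind-yes : {A : Set} (d : Dec A) → A → ind d ≡ 1
ind-yes (yes _) a = refl
ind-yes (no ¬a) a = contradiction a ¬a

ind-no : {A : Set} (d : Dec A) → ¬ A → ind d ≡ 0
ind-no (yes a) ¬a = contradiction a ¬a
ind-no (no _) ¬a = refl

ind≤1 : {A : Set} (d : Dec A) → ind d ≤ 1
ind≤1 (yes _) = ≤-refl
ind≤1 (no _) = z≤n

ind-mono : {A B : Set} (d : Dec A) (e : Dec B) → (A → B) → ind d ≤ ind e
ind-mono (no _) e f = z≤n
ind-mono (yes a) e f = ≤-reflexive (sym (ind-yes e (f a)))

sum-mono : {f g : Fin k → ℕ} → (∀ i → f i ≤ g i) → sum f ≤ sum g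
sum-mono {zero} f≤g = z≤n
sum-mono {suc k} f≤g = +-mono-≤ (f≤g zero) (sum-mono (f≤g ∘ suc))

sum-zero : {f : Fin k → ℕ} → (∀ i → f i ≡ 0) → sum f ≡ 0
sum-zero {k} f≡0 = trans (sum-cong-≗ f≡0) (sum-replicate-zero k)

sum-point : (a : Fin k) → sum (λ i → ind (i ≟ a)) ≡ 1
sum-point {suc k} zero = cong suc (sum-zero {k} {λ i → ind (suc i ≟ zero {k})} λ _ → refl)
sum-point (suc a) = sum-point a

sum-+-point : (f : Fin k → ℕ) (a : Fin k) → sum (λ i → f i + ind (i ≟ a)) ≡ sum f + 1
sum-+-point f a = trans (∑-distrib-+ f (λ i → ind (i ≟ a))) (cong (sum f +_) (sum-point a))

term≤sum : (f : Fin k → ℕ) (i : Fin k) → f i ≤ sum f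
term≤sum f zero = m≤m+n _ _
term≤sum f (suc i) = ≤-trans (term≤sum (f ∘ suc) i) (m≤n+m _ _)

two-terms≤sum : (f : Fin k → ℕ) {i j : Fin k} → i ≢ j → f i + f j ≤ sum f
two-terms≤sum f {zero} {zero} i≢j = contradiction refl i≢j
two-terms≤sum f {zero} {suc j} i≢j = +-monoʳ-≤ (f zero) (term≤sum (f ∘ suc) j)
two-terms≤sum f {suc i} {zero} i≢j =
  ≤-trans (≤-reflexive (+-comm (f (suc i)) (f zero))) (+-monoʳ-≤ (f zero) (term≤sum (f ∘ suc) i))
two-terms≤sum f {suc i} {suc j} i≢j =
  ≤-trans (two-terms≤sum (f ∘ suc) (i≢j ∘ cong suc)) (m≤n+m _ _)

-- Turns a count back into witnesses: it lists the edges of a matching and picks a vertex from a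
-- nonempty set.
enumerate : ∀ {m} {P : Fin k → Set} (P? : Decidable P) → m ≤ sum (λ i → ind (P? i)) →
  Σ[ g ∈ (Fin m → Fin k) ] (∀ p q → g p ≡ g q → p ≡ q) × (∀ p → P (g p))
enumerate {zero} {zero} P? m≤ = (λ ()) , (λ ()) , λ ()
enumerate {suc k} {zero} P? m≤ = (λ ()) , (λ ()) , λ ()
enumerate {suc k} {suc m} P? m≤ with P? zero
... | yes p₀ =
  let g , g-inj , Pg = enumerate (P? ∘ suc) (s≤s⁻¹ m≤)
      inj : ∀ p q → (zero ∷ (suc ∘ g)) p ≡ (zero ∷ (suc ∘ g)) q → p ≡ q
      inj = λ { zero zero _ → refl ; zero (suc _) () ; (suc _) zero () ; (suc p) (suc q) eq → cong suc (g-inj p q (suc-injective eq)) }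
  in zero ∷ (suc ∘ g) , inj , λ { zero → p₀ ; (suc p) → Pg p }
... | no _ =
  let g , g-inj , Pg = enumerate (P? ∘ suc) m≤
  in suc ∘ g , (λ p q → g-inj p q ∘ suc-injective) , Pg

-- Exhaustive search, one value at a time. `resp` stands in for function extensionality, as `f` is
-- only pointwise equal to `head f ∷ tail f`.
anyFunction? : {P : (Fin k → Fin l) → Set} → (∀ {f g} → f ≗ g → P f → P g) →
  Decidable P → Dec (∃ P)
anyFunction? {zero} resp P? =
  map′ ([] ,_) (λ (f , p) → resp {f} {[]} (λ ()) p) (P? [])
anyFunction? {suc k} resp P? =
  map′ (λ (a , f , p) → a ∷ f , p)
       (λ (f , p) → head f , tail f , resp (λ { zero → refl ; (suc i) → refl }) p)
       (any? λ a → anyFunction? (λ f≗g → resp λ { zero → refl ; (suc i) → f≗g i }) λ f → P? (a ∷ f))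

-- Matchings as involutions

module _ {V : ℕ} where

  Vertex : Set
  Vertex = Fin V

  -- A matching is given by the involution exchanging partners, whose fixed points are the missed vertices.
  record Matching (E : Vertex → Vertex → Set) : Set where
    field
      mate       : Vertex → Vertex
      involutive : ∀ u → mate (mate u) ≡ u
      mate-edge  : ∀ u → mate u ≢ u → E u (mate u)

  open Matching public

  coverage : (Vertex → Vertex) → Vertex → ℕ
  coverage f u = ind (¬? (f u ≟ u))

  -- Vertices are counted rather than edges, so that coverage can be summed vertex by vertex; a
  -- matching of `m` edges has order `m + m`.
  order : (Vertex → Vertex) → ℕ
  order f = sum (coverage f)

  covered : (f : Vertex → Vertex) {u : Vertex} → f u ≢ u → coverage f u ≡ 1
  covered f {u} = ind-yes (¬? (f u ≟ u))

  missed : (f : Vertex → Vertex) {u : Vertex} → f u ≡ u → coverage f u ≡ 0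
  missed f {u} eq = ind-no (¬? (f u ≟ u)) (λ ne → ne eq)

  coverage≤1 : ∀ f u → coverage f u ≤ 1
  coverage≤1 f u = ind≤1 (¬? (f u ≟ u))

  coverage-cong : ∀ f g {u} → f u ≡ g u → coverage f u ≡ coverage g u
  coverage-cong f g eq rewrite eq = refl

  emptyMatching : ∀ {E} → Matching E
  emptyMatching .mate u = u
  emptyMatching .involutive u = refl
  emptyMatching .mate-edge u ne = contradiction refl ne

  mapMatching : ∀ {E E′ : Vertex → Vertex → Set} → (∀ {u w} → E u w → E′ u w) → Matching E → Matching E′
  mapMatching f M .mate = mate M
  mapMatching f M .involutive = involutive M
  mapMatching f M .mate-edge u ne = f (mate-edge M u ne)

  edgeCount : (Vertex → Vertex) → ℕ
  edgeCount f = sum λ u → ind (u F.<? f u)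

  -- A covered vertex is the smaller or the larger end of its edge, and permuting the vertices by
  -- `f` exchanges the two kinds.
  order≡edgeCount+edgeCount : (f : Vertex → Vertex) → (∀ u → f (f u) ≡ u) → order f ≡ edgeCount f + edgeCount f
  order≡edgeCount+edgeCount f inv = begin
    order f                                          ≡⟨ sum-cong-≗ split ⟩
    sum (λ u → ind (u F.<? f u) + ind (f u F.<? u))  ≡⟨ ∑-distrib-+ (λ u → ind (u F.<? f u)) (λ u → ind (f u F.<? u)) ⟩
    edgeCount f + sum (λ u → ind (f u F.<? u))       ≡⟨ cong (edgeCount f +_) flip ⟩
    edgeCount f + edgeCount f                        ∎
    where
    open ≡-Reasoning
    split : ∀ u → coverage f u ≡ ind (u F.<? f u) + ind (f u F.<? u)
    split u with F.<-cmp u (f u)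
    ... | tri< lt ne ngt = trans (covered f (ne ∘ sym))
            (sym (cong₂ _+_ (ind-yes (u F.<? f u) lt) (ind-no (f u F.<? u) ngt)))
    ... | tri≈ nlt eq ngt = trans (missed f (sym eq))
            (sym (cong₂ _+_ (ind-no (u F.<? f u) nlt) (ind-no (f u F.<? u) ngt)))
    ... | tri> nlt ne gt = trans (covered f (ne ∘ sym))
            (sym (cong₂ _+_ (ind-no (u F.<? f u) nlt) (ind-yes (f u F.<? u) gt)))
    flip : sum (λ u → ind (f u F.<? u)) ≡ edgeCount f
    flip = trans (sum-permute _ (permutation f f inv inv))
                 (sum-cong-≗ λ u → cong (λ w → ind (w F.<? f u)) (inv u))

  -- Exchanging edges, and Gallai's lemma

  module _ {E : Vertex → Vertex → Set} (E-sym : ∀ {u w} → E u w → E w u) where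

    -- Swap in the edge ab; if b was matched, its former partner becomes unmatched.
    module Rotate (M : Matching E) {a b : Vertex} (Ma : mate M a ≡ a) (a≢b : a ≢ b) (Eab : E a b) where
      private
        f = mate M
        c = f b

        g : Vertex → Vertex
        -- `b` is tested before `c`, because the two coincide when `b` was missed.
        g u = if does (u ≟ a) then b else if does (u ≟ b) then a else if does (u ≟ c) then c else f u

        f-injective : ∀ {u w} → f u ≡ f w → u ≡ w
        f-injective {u} {w} eq = trans (sym (involutive M u)) (trans (cong f eq) (involutive M w))

        c≢a : c ≢ a
        c≢a eq = a≢b (sym (f-injective (trans eq (sym Ma))))

        g-other : ∀ {u} → u ≢ a → u ≢ b → u ≢ c → g u ≡ f u
        g-other {u} u≢a u≢b u≢c with u ≟ a | u ≟ b | u ≟ c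
        ... | yes eq | _ | _ = contradiction eq u≢a
        ... | no _ | yes eq | _ = contradiction eq u≢b
        ... | no _ | no _ | yes eq = contradiction eq u≢c
        ... | no _ | no _ | no _ = refl

      g-a : g a ≡ b
      g-a with a ≟ a
      ... | yes _ = refl
      ... | no ne = contradiction refl ne

      g-b : g b ≡ a
      g-b with b ≟ a | b ≟ b
      ... | yes eq | _ = contradiction (sym eq) a≢b
      ... | no _ | yes _ = refl
      ... | no _ | no ne = contradiction refl ne

      g-c : c ≢ b → g c ≡ c
      g-c c≢b with c ≟ a | c ≟ b | c ≟ c
      ... | yes eq | _ | _ = contradiction eq c≢a
      ... | no _ | yes eq | _ = contradiction eq c≢b
      ... | no _ | no _ | yes _ = refl
      ... | no _ | no _ | no ne = contradiction refl ne

      data Position (u : Vertex) : Set where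
        at-a  : u ≡ a → Position u
        at-b  : u ≡ b → Position u
        at-c  : u ≡ c → u ≢ a → u ≢ b → Position u
        other : u ≢ a → u ≢ b → u ≢ c → g u ≡ f u → Position u

      position : ∀ u → Position u
      position u with u ≟ a
      ... | yes eq = at-a eq
      ... | no u≢a with u ≟ b
      ...   | yes eq = at-b eq
      ...   | no u≢b with u ≟ c
      ...     | yes eq = at-c eq u≢a u≢b
      ...     | no u≢c = other u≢a u≢b u≢c (g-other u≢a u≢b u≢c)

      rotated : Matching E
      rotated .mate = g
      rotated .involutive u with position u
      ... | at-a refl = trans (cong g g-a) g-b
      ... | at-b refl = trans (cong g g-b) g-a
      ... | at-c refl _ u≢b = trans (cong g (g-c u≢b)) (g-c u≢b)
      ... | other u≢a u≢b u≢c eq = trans (cong g eq) (trans (g-other fu≢a fu≢b fu≢c) (involutive M u))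
        where
        fu≢a : f u ≢ a
        fu≢a e = u≢a (f-injective (trans e (sym Ma)))
        fu≢b : f u ≢ b
        fu≢b e = u≢c (trans (sym (involutive M u)) (cong f e))
        fu≢c : f u ≢ c
        fu≢c e = u≢b (f-injective e)
      rotated .mate-edge u ne with position u
      ... | at-a refl = subst (E a) (sym g-a) Eab
      ... | at-b refl = subst (E b) (sym g-b) (E-sym Eab)
      ... | at-c refl _ u≢b = contradiction (g-c u≢b) ne
      ... | other _ _ _ eq = subst (E u) (sym eq) (mate-edge M u (ne ∘ trans eq))

      cover-a : coverage g a ≡ 1
      cover-a = covered g (λ eq → a≢b (trans (sym eq) g-a))

      cover-b : coverage g b ≡ 1
      cover-b = covered g (λ eq → a≢b (trans (sym g-b) eq))

      -- When `b` was missed too, no vertex becomes uncovered; counting the gain at `a` alone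
      -- suffices.
      order-extend : f b ≡ b → order f < order g
      order-extend fb = begin-strict
        order f <⟨ n<1+n _ ⟩
        suc (order f) ≡⟨ +-comm 1 (order f) ⟩
        order f + 1 ≡⟨ sum-+-point (coverage f) a ⟨
        sum (λ u → coverage f u + ind (u ≟ a)) ≤⟨ sum-mono pointwise ⟩
        order g ∎
        where
        open ≤-Reasoning
        pointwise : ∀ u → coverage f u + ind (u ≟ a) ≤ coverage g u
        pointwise u with position u
        ... | at-a refl = ≤-reflexive (trans (cong₂ _+_ (missed f Ma) (ind-yes (a ≟ a) refl)) (sym cover-a))
        ... | at-b refl = ≤-trans (≤-reflexive (cong₂ _+_ (missed f fb) (ind-no (b ≟ a) (a≢b ∘ sym)))) z≤n
        ... | at-c refl _ u≢b = contradiction fb u≢b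
        ... | other u≢a _ _ eq = ≤-reflexive (trans (cong₂ _+_ (coverage-cong f g (sym eq)) (ind-no (u ≟ a) u≢a)) (+-identityʳ _))

      -- `a` becomes covered, and only `c` can become uncovered.
      order-preserved : order f ≤ order g
      order-preserved = +-cancelʳ-≤ 1 (order f) (order g) (begin
        order f + 1 ≡⟨ sum-+-point (coverage f) a ⟨
        sum (λ u → coverage f u + ind (u ≟ a)) ≤⟨ sum-mono pointwise ⟩
        sum (λ u → coverage g u + ind (u ≟ c)) ≡⟨ sum-+-point (coverage g) c ⟩
        order g + 1 ∎)
        where
        open ≤-Reasoning
        pointwise : ∀ u → coverage f u + ind (u ≟ a) ≤ coverage g u + ind (u ≟ c)
        pointwise u with position u
        ... | at-a refl = ≤-trans (≤-reflexive (trans (cong₂ _+_ (missed f Ma) (ind-yes (a ≟ a) refl)) (sym cover-a))) (m≤m+n _ _)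
        ... | at-b refl = ≤-trans
                (+-mono-≤ (coverage≤1 f b) (≤-reflexive (ind-no (b ≟ a) (a≢b ∘ sym))))
                (≤-trans (≤-reflexive (sym cover-b)) (m≤m+n _ _))
        ... | at-c refl u≢a _ = ≤-trans
                (+-mono-≤ (coverage≤1 f c) (≤-reflexive (ind-no (c ≟ a) u≢a)))
                (≤-trans (≤-reflexive (sym (ind-yes (c ≟ c) refl))) (m≤n+m _ (coverage g c)))
        ... | other u≢a _ u≢c eq = ≤-reflexive (cong₂ _+_ (coverage-cong f g (sym eq))
                (trans (ind-no (u ≟ a) u≢a) (sym (ind-no (u ≟ c) u≢c))))

    module _ {s : ℕ} (bound : (M : Matching E) → order (mate M) ≤ s) where

      -- Were `b` missed as well, adding the edge `ab` would push the order above `s`.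
      maximum-covers : (M : Matching E) → s ≤ order (mate M) → ∀ {a b} →
        mate M a ≡ a → a ≢ b → E a b → mate M b ≢ b
      maximum-covers M M-max Ma a≢b Eab Mb =
        <⇒≱ (≤-<-trans M-max (order-extend Mb)) (bound rotated)
        where open Rotate M Ma a≢b Eab

      disagreement : (M N : Matching E) → ℕ
      disagreement M N = sum λ u → ind (¬? (mate M u ≟ mate N u))

      agree : (M N : Matching E) → ∀ {u} → mate M u ≡ mate N u → ind (¬? (mate M u ≟ mate N u)) ≡ 0
      agree M N {u} eq = ind-no (¬? (mate M u ≟ mate N u)) λ ne → ne eq

      disagree : (M N : Matching E) → ∀ {u} → mate M u ≢ mate N u → ind (¬? (mate M u ≟ mate N u)) ≡ 1
      disagree M N {u} = ind-yes (¬? (mate M u ≟ mate N u))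

      -- The rotated matching agrees with `M` at `w` and at its partner `b`. The old partner of `b`
      -- in `N` adds no new disagreement: `M` matches `b` to `w`, so `M` and `N` already differed
      -- there.
      rotate-towards : (M N : Matching E) {w : Vertex} (Nw : mate N w ≡ w) (Mw : mate M w ≢ w) →
        mate N (mate M w) ≢ mate M w →
        disagreement M (Rotate.rotated N Nw (Mw ∘ sym) (mate-edge M w Mw)) < disagreement M N
      rotate-towards M N {w} Nw Mw Nb = begin-strict
        disagreement M rotated <⟨ n<1+n _ ⟩
        suc (disagreement M rotated) ≡⟨ +-comm 1 _ ⟩
        disagreement M rotated + 1 ≡⟨ sum-+-point (λ u → ind (¬? (mate M u ≟ mate rotated u))) w ⟨
        sum (λ u → ind (¬? (mate M u ≟ mate rotated u)) + ind (u ≟ w)) ≤⟨ sum-mono pointwise ⟩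
        disagreement M N ∎
        where
        open ≤-Reasoning
        open Rotate N Nw (Mw ∘ sym) (mate-edge M w Mw)
        b = mate M w
        pointwise : ∀ u → ind (¬? (mate M u ≟ mate rotated u)) + ind (u ≟ w) ≤ ind (¬? (mate M u ≟ mate N u))
        pointwise u with position u
        ... | at-a refl = ≤-reflexive (trans (cong₂ _+_ (agree M rotated (sym g-a)) (ind-yes (w ≟ w) refl))
                (sym (disagree M N λ eq → Mw (trans eq Nw))))
        ... | at-b refl = ≤-trans (≤-reflexive (cong₂ _+_
                (agree M rotated (trans (involutive M w) (sym g-b))) (ind-no (b ≟ w) Mw))) z≤n
        ... | at-c refl u≢w _ = ≤-trans
                (+-mono-≤ (ind≤1 (¬? (mate M (mate N b) ≟ mate rotated (mate N b))))
                          (≤-reflexive (ind-no (mate N b ≟ w) u≢w)))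
                (≤-reflexive (sym (disagree M N λ eq → u≢w
                  (trans (sym (involutive M _)) (trans (cong (mate M) (trans eq (involutive N b))) (involutive M w))))))
        ... | other u≢w _ _ eq rewrite eq =
                ≤-reflexive (trans (cong (ind (¬? (mate M u ≟ mate N u)) +_) (ind-no (u ≟ w) u≢w)) (+-identityʳ _))

      -- Gallai's lemma at distance two.  By counting, some w ≢ z is covered by M but not by N;
      -- rotating N towards the edge of M at w keeps z missed and makes N agree more with M.
      neighbours-not-both-missed : ∀ k (M N : Matching E) → disagreement M N < k →
        s ≤ order (mate M) → s ≤ order (mate N) → ∀ {x y z} →
        E z x → E z y → z ≢ x → z ≢ y → x ≢ y →
        mate M x ≡ x → mate M y ≡ y → mate N z ≢ z
      neighbours-not-both-missed zero M N () _ _ _ _ _ _ _ _ _ _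
      neighbours-not-both-missed (suc k) M N M-N<k M-max N-max {x} {y} {z} Ezx Ezy z≢x z≢y x≢y Mx My Nz
        with any? (λ w → ¬? (w ≟ z) ×-dec (¬? (mate M w ≟ w) ×-dec (mate N w ≟ w)))
      ... | yes (w , w≢z , Mw , Nw) =
        neighbours-not-both-missed k M rotated (<-≤-trans (rotate-towards M N Nw Mw Nb) (s≤s⁻¹ M-N<k))
          M-max (≤-trans N-max order-preserved) Ezx Ezy z≢x z≢y x≢y Mx My rotated-z
        where
        open Rotate N Nw (Mw ∘ sym) (mate-edge M w Mw)
        Nb : mate N (mate M w) ≢ mate M w
        Nb = maximum-covers N N-max Nw (Mw ∘ sym) (mate-edge M w Mw)
        rotated-z : mate rotated z ≡ z
        rotated-z with position z
        ... | at-a eq = contradiction (sym eq) w≢z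
        ... | at-b refl = contradiction Nz Nb
        ... | at-c refl _ z≢b = g-c z≢b
        ... | other _ _ _ eq = trans eq Nz
      ... | no none = <⇒≱ (≤-<-trans M-max (m<m+n (order (mate M)) (s≤s z≤n)))
                          (≤-trans (+-cancelʳ-≤ 1 _ _ counting) (bound N))
        where
        open ≤-Reasoning
        -- `N` is maximum and misses `z`, so it covers the neighbours `x` and `y`, which `M` misses;
        -- by `none` it also covers all that `M` covers, except perhaps `z`. That is two gains
        -- against one loss.
        pointwise : ∀ u → coverage (mate M) u + ind (u ≟ x) + ind (u ≟ y) ≤ coverage (mate N) u + ind (u ≟ z)
        pointwise u with u ≟ x
        ... | yes refl = ≤-trans
                (≤-reflexive (cong₂ _+_ (cong (_+ 1) (missed (mate M) Mx)) (ind-no (u ≟ y) x≢y)))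
                (≤-trans (≤-reflexive (sym (covered (mate N) (maximum-covers N N-max Nz z≢x Ezx)))) (m≤m+n _ _))
        ... | no u≢x with u ≟ y
        ...   | yes refl = ≤-trans
                (≤-reflexive (cong (λ t → t + 0 + 1) (missed (mate M) My)))
                (≤-trans (≤-reflexive (sym (covered (mate N) (maximum-covers N N-max Nz z≢y Ezy)))) (m≤m+n _ _))
        ...   | no u≢y with u ≟ z
        ...     | yes refl = ≤-trans
                (≤-reflexive (trans (+-identityʳ _) (+-identityʳ _)))
                (≤-trans (coverage≤1 (mate M) u) (m≤n+m _ _))
        ...     | no u≢z = +-monoˡ-≤ 0 (≤-trans (≤-reflexive (+-identityʳ _))
                (ind-mono (¬? (mate M u ≟ u)) (¬? (mate N u ≟ u)) λ Mu Nu → none (u , u≢z , Mu , Nu)))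
        counting : order (mate M) + 1 + 1 ≤ order (mate N) + 1
        counting = begin
          order (mate M) + 1 + 1
            ≡⟨ cong (_+ 1) (sum-+-point (coverage (mate M)) x) ⟨
          sum (λ u → coverage (mate M) u + ind (u ≟ x)) + 1
            ≡⟨ sum-+-point (λ u → coverage (mate M) u + ind (u ≟ x)) y ⟨
          sum (λ u → coverage (mate M) u + ind (u ≟ x) + ind (u ≟ y))
            ≤⟨ sum-mono pointwise ⟩
          sum (λ u → coverage (mate N) u + ind (u ≟ z))
            ≡⟨ sum-+-point (coverage (mate N)) z ⟩
          order (mate N) + 1 ∎

  -- Deciding the existence of matchings

  AnyMatching : (E : Vertex → Vertex → Set) → ((Vertex → Vertex) → Set) → Set
  AnyMatching E P = Σ[ M ∈ Matching E ] P (mate M)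

  -- `P` sees only the function `mate`, so a search over all functions on vertices decides
  -- existence. The later case distinctions on maximum matchings rest on this.
  anyMatching? : {E : Vertex → Vertex → Set} {P : (Vertex → Vertex) → Set} → (∀ u w → Dec (E u w)) →
    (∀ {f g} → f ≗ g → P f → P g) → Decidable P → Dec (AnyMatching E P)
  anyMatching? {E} {P} E? resp P? = map′ to from (anyFunction? resp′ λ f →
      all? (λ u → f (f u) ≟ u) ×-dec (all? (λ u → ¬? (f u ≟ u) →-dec E? u (f u)) ×-dec P? f))
    where
    Good : (Vertex → Vertex) → Set
    Good f = (∀ u → f (f u) ≡ u) × (∀ u → f u ≢ u → E u (f u)) × P f
    resp′ : ∀ {f g} → f ≗ g → Good f → Good g
    resp′ {f} {g} f≗g (inv , edg , p) =
      (λ u → trans (sym (trans (f≗g (f u)) (cong g (f≗g u)))) (inv u)) ,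
      (λ u ne → subst (E u) (f≗g u) (edg u (ne ∘ trans (sym (f≗g u))))) ,
      resp f≗g p
    to : ∃ Good → AnyMatching E P
    to (f , inv , edg , p) = record { mate = f ; involutive = inv ; mate-edge = edg } , p
    from : AnyMatching E P → ∃ Good
    from (M , p) = mate M , involutive M , mate-edge M , p

  order-cong : {f g : Vertex → Vertex} → f ≗ g → order f ≡ order g
  order-cong {f} {g} f≗g = sum-cong-≗ λ u → coverage-cong f g (f≗g u)

doubled-< : ∀ {a b} → a + a < b + b → a < b
doubled-< {a} {b} lt with a ℕ.<? b
... | yes a<b = a<b
... | no a≮b = contradiction lt (≤⇒≯ (+-mono-≤ (≮⇒≥ a≮b) (≮⇒≥ a≮b)))

-- Parity: the order is even, so missing `m + m` at all means missing it by two.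
order<⇒order≤ : ∀ {V m} {E : Fin V → Fin V → Set} (M : Matching E) →
  order (mate M) < m + m → order (mate M) ≤ (m ∸ 1) + (m ∸ 1)
order<⇒order≤ {m = m} M lt rewrite order≡edgeCount+edgeCount (mate M) (involutive M) =
  +-mono-≤ half half
  where half = <⇒≤pred (doubled-< {edgeCount (mate M)} {m} lt)

-- The upper bound in a graph that is complete away from `v`

module AlmostComplete {V c : ℕ}
  (Adj : Fin V → Fin V → Set) (Adj? : ∀ u w → Dec (Adj u w))
  (Adj-sym : ∀ {u w} → Adj u w → Adj w u) (Adj⇒≢ : ∀ {u w} → Adj u w → u ≢ w)
  (v : Fin V) (complete : ∀ {u w} → u ≢ w → u ≢ v → w ≢ v → Adj u w)
  (col : Fin V → Fin V → Fin c) (col-sym : ∀ u w → col u w ≡ col w u)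
  where

  -- `X` is the set of vertices not yet deleted.
  Edge : (Fin V → Set) → Fin c → Fin V → Fin V → Set
  Edge X i u w = X u × X w × Adj u w × col u w ≡ i

  Edge-sym : ∀ {X i u w} → Edge X i u w → Edge X i w u
  Edge-sym (Xu , Xw , a , eq) = Xw , Xu , Adj-sym a , trans (col-sym _ _) eq

  Edge? : ∀ {X} → Decidable X → ∀ i u w → Dec (Edge X i u w)
  Edge? X? i u w = X? u ×-dec (X? w ×-dec (Adj? u w ×-dec (col u w ≟ i)))

  -- Used with `y` equal to `x` to say that a large matching misses `x`.
  AvoidsBoth : (Fin V → Set) → Fin c → ℕ → Fin V → Fin V → Set
  AvoidsBoth X i s x y = AnyMatching (Edge X i) λ f → s ≤ order f × f x ≡ x × f y ≡ y

  avoidsBoth? : ∀ {X} → Decidable X → ∀ i s x y → Dec (AvoidsBoth X i s x y)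
  avoidsBoth? X? i s x y = anyMatching? (Edge? X? i)
    (λ f≗g (le , fx , fy) → ≤-trans le (≤-reflexive (order-cong f≗g)) ,
      trans (sym (f≗g x)) fx , trans (sym (f≗g y)) fy)
    λ f → (s ℕ.≤? order f) ×-dec ((f x ≟ x) ×-dec (f y ≟ y))

  -- Every vertex is missed by a maximum matching in every colour

  module NoEssentialVertex (X : Fin V → Set) (X? : Decidable X) (m : Fin c → ℕ)
    (bound : ∀ i (M : Matching (Edge X i)) → order (mate M) ≤ m i + m i)
    (avoid : ∀ i {x} → X x → AvoidsBoth X i (m i + m i) x x)
    where

    Linked : Fin c → Fin V → Fin V → Set
    Linked i x y = ¬ AvoidsBoth X i (m i + m i) x y

    Linked? : ∀ i x y → Dec (Linked i x y)
    Linked? i x y = ¬? (avoidsBoth? X? i (m i + m i) x y)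

    adjacent⇒linked : ∀ {x y} → X x → X y → Adj x y → Linked (col x y) x y
    adjacent⇒linked Xx Xy a (M , M-max , Mx , My) =
      maximum-covers Edge-sym (bound _) M M-max Mx (Adj⇒≢ a) (Xx , Xy , a , refl) My

    Other : Fin V → Set
    Other w = X w × w ≢ v

    Other? : Decidable Other
    Other? w = X? w ×-dec ¬? (w ≟ v)

    Joined : Fin V → Fin V → Set
    Joined x w = w ≡ v × X v × Adj x v

    Joined? : ∀ x → Decidable (Joined x)
    Joined? x w = (w ≟ v) ×-dec (X? v ×-dec Adj? x v)

    -- The coverage demanded of the matchings chosen for `x`. The odd unit at a neighbour `v` of `x`
    -- is what later makes an inequality strict after halving.
    weight : Fin V → Fin V → ℕ
    weight x w = ind (Other? w) + ind (Other? w) + ind (Joined? x w)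

    module _ {x : Fin V} (Xx : X x) (x≢v : x ≢ v)
      (A : ∀ i → Matching (Edge X i)) (A-max : ∀ i → m i + m i ≤ order (mate (A i)))
      (Ax : ∀ i → mate (A i) x ≡ x) where

      total : Fin V → ℕ
      total w = sum λ i → coverage (mate (A i)) w

      adjacent-covered : ∀ {w} → X w → Adj x w → 1 ≤ coverage (mate (A (col x w))) w
      adjacent-covered {w} Xw a = ≤-reflexive (sym (covered (mate (A (col x w)))
        (maximum-covers Edge-sym (bound _) (A (col x w)) (A-max _) (Ax _) (Adj⇒≢ a) (Xx , Xw , a , refl))))

      adjacent-total : ∀ {w} → X w → Adj x w → 1 ≤ total w
      adjacent-total {w} Xw a =
        ≤-trans (adjacent-covered Xw a) (term≤sum (λ i → coverage (mate (A i)) w) (col x w))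

      joined-total : ∀ w → ind (Joined? x w) ≤ total w
      joined-total w with Joined? x w
      ... | yes (refl , Xv , a) = ≤-trans (ind≤1 (Joined? x w)) (adjacent-total Xv a)
      ... | no ¬j = ≤-trans (≤-reflexive (ind-no (Joined? x w) ¬j)) z≤n

      sum-total : sum total ≤ sum m + sum m
      sum-total = begin
        sum total ≡⟨ ∑-comm (λ w i → coverage (mate (A i)) w) ⟩
        sum (λ i → order (mate (A i))) ≤⟨ sum-mono (λ i → bound i (A i)) ⟩
        sum (λ i → m i + m i) ≡⟨ ∑-distrib-+ m m ⟩
        sum m + sum m ∎
        where open ≤-Reasoning

      -- Double counting of coverage. One unit is granted free at `x` and one at `y`, hence the
      -- final `+ 1 + 1`; with `y` equal to `x`, both go to `x`.
      weight≤ : ∀ {i₀} y (B : Matching (Edge X i₀)) →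
        (∀ w → weight x w ≤ total w + coverage (mate B) w + ind (w ≟ x) + ind (w ≟ y)) →
        sum (weight x) ≤ sum m + sum m + (m i₀ + m i₀) + 1 + 1
      weight≤ {i₀} y B pointwise = begin
        sum (weight x)
          ≤⟨ sum-mono pointwise ⟩
        sum (λ w → total w + coverage (mate B) w + ind (w ≟ x) + ind (w ≟ y))
          ≡⟨ sum-+-point (λ w → total w + coverage (mate B) w + ind (w ≟ x)) y ⟩
        sum (λ w → total w + coverage (mate B) w + ind (w ≟ x)) + 1
          ≡⟨ cong (_+ 1) (sum-+-point (λ w → total w + coverage (mate B) w) x) ⟩
        sum (λ w → total w + coverage (mate B) w) + 1 + 1
          ≡⟨ cong (λ t → t + 1 + 1) (∑-distrib-+ total (coverage (mate B))) ⟩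
        sum total + order (mate B) + 1 + 1
          ≤⟨ +-monoˡ-≤ 1 (+-monoˡ-≤ 1 (+-mono-≤ sum-total (bound i₀ B))) ⟩
        sum m + sum m + (m i₀ + m i₀) + 1 + 1 ∎
        where open ≤-Reasoning

      weight-v : ∀ {w} → w ≡ v → weight x w ≤ total w
      weight-v {w} w≡v = begin
        weight x w ≡⟨ cong (λ t → t + t + ind (Joined? x w)) (ind-no (Other? w) λ o → proj₂ o w≡v) ⟩
        ind (Joined? x w) ≤⟨ joined-total w ⟩
        total w ∎
        where open ≤-Reasoning

      weight-outside : ∀ {w} → w ≢ v → ¬ X w → weight x w ≡ 0
      weight-outside {w} w≢v ¬Xw = trans
        (cong (λ t → t + t + ind (Joined? x w)) (ind-no (Other? w) (¬Xw ∘ proj₁)))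
        (ind-no (Joined? x w) (w≢v ∘ proj₁))

      weight≤2 : ∀ {w} → w ≢ v → weight x w ≤ 2
      weight≤2 {w} w≢v = +-mono-≤ (+-mono-≤ (ind≤1 (Other? w)) (ind≤1 (Other? w)))
        (≤-reflexive (ind-no (Joined? x w) (w≢v ∘ proj₁)))

      -- At `x`, which every `A i` misses, one unit is granted and `at-x` supplies the other; at a
      -- different `y` one is granted and the `A i` supply the other. The single unit that may be
      -- demanded at `v` comes from the matching in the colour of `xv`.
      weight-pointwise : ∀ {i₀} y (B : Matching (Edge X i₀)) →
        1 ≤ coverage (mate B) x + ind (x ≟ y) →
        (y ≢ x → 1 ≤ total y) →
        (∀ {w} → X w → w ≢ v → w ≢ x → w ≢ y → 2 ≤ total w + coverage (mate B) w) →
        ∀ w → weight x w ≤ total w + coverage (mate B) w + ind (w ≟ x) + ind (w ≟ y)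
      weight-pointwise y B at-x at-y twice w = by-cases (w ≟ v) (X? w)
        where
        open ≤-Reasoning
        goal = total w + coverage (mate B) w + ind (w ≟ x) + ind (w ≟ y)
        two : X w → w ≢ v → 2 ≤ goal
        two Xw w≢v with w ≟ x
        ... | yes refl = begin
                1 + 1 ≤⟨ +-monoʳ-≤ 1 at-x ⟩
                1 + (coverage (mate B) w + ind (w ≟ y)) ≡⟨ +-assoc 1 (coverage (mate B) w) _ ⟨
                1 + coverage (mate B) w + ind (w ≟ y) ≡⟨ cong (_+ ind (w ≟ y)) (+-comm 1 (coverage (mate B) w)) ⟩
                coverage (mate B) w + 1 + ind (w ≟ y)
                  ≤⟨ +-monoˡ-≤ (ind (w ≟ y)) (+-monoˡ-≤ 1 (m≤n+m _ (total w))) ⟩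
                total w + coverage (mate B) w + 1 + ind (w ≟ y) ∎
        ... | no w≢x with w ≟ y
        ...   | yes refl = +-monoˡ-≤ 1 (≤-trans (at-y w≢x) (≤-trans (m≤m+n _ _) (m≤m+n _ 0)))
        ...   | no w≢y = ≤-trans (twice Xw w≢v w≢x w≢y) (≤-trans (m≤m+n _ 0) (m≤m+n _ 0))
        by-cases : Dec (w ≡ v) → Dec (X w) → weight x w ≤ goal
        by-cases (yes w≡v) _ =
          ≤-trans (weight-v w≡v) (≤-trans (m≤m+n _ _) (≤-trans (m≤m+n _ _) (m≤m+n _ (ind (w ≟ y)))))
        by-cases (no w≢v) (no ¬Xw) = ≤-trans (≤-reflexive (weight-outside w≢v ¬Xw)) z≤n
        by-cases (no w≢v) (yes Xw) = ≤-trans (weight≤2 w≢v) (two Xw w≢v)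

    weight-bound : ∀ {x} → X x → x ≢ v →
      ∃[ i₀ ] sum (weight x) ≤ sum m + sum m + (m i₀ + m i₀) + 1 + 1
    weight-bound {x} Xx x≢v with any? (λ y → X? y ×-dec (¬? (y ≟ v) ×-dec (¬? (y ≟ x) ×-dec
      ¬? (any? λ i → any? λ j → ¬? (i ≟ j) ×-dec (Linked? i x y ×-dec Linked? j x y)))))
    -- Every other vertex is linked to `x` twice, so the `A i` suffice and `B` is empty. Its colour
    -- `col x x` is an arbitrary default.
    ... | no none = col x x , weight≤ Xx x≢v A A-max Ax x B
            (weight-pointwise Xx x≢v A A-max Ax x B at-x (contradiction refl) twice)
      where
      A : ∀ i → Matching (Edge X i)
      A i = proj₁ (avoid i Xx)
      A-max : ∀ i → m i + m i ≤ order (mate (A i))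
      A-max i = proj₁ (proj₂ (avoid i Xx))
      Ax : ∀ i → mate (A i) x ≡ x
      Ax i = proj₁ (proj₂ (proj₂ (avoid i Xx)))
      B : Matching (Edge X (col x x))
      B = emptyMatching
      at-x : 1 ≤ coverage (mate B) x + ind (x ≟ x)
      at-x = ≤-trans (≤-reflexive (sym (ind-yes (x ≟ x) refl))) (m≤n+m _ _)
      linked-covered : ∀ {i w} → Linked i x w → 1 ≤ coverage (mate (A i)) w
      linked-covered {i} {w} li = ≤-reflexive (sym (covered (mate (A i)) λ Aw → li (A i , A-max i , Ax i , Aw)))
      twice : ∀ {w} → X w → w ≢ v → w ≢ x → w ≢ x →
        2 ≤ total Xx x≢v A A-max Ax w + coverage (mate B) w
      twice {w} Xw w≢v w≢x _
        with any? (λ i → any? λ j → ¬? (i ≟ j) ×-dec (Linked? i x w ×-dec Linked? j x w))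
      ... | no few = contradiction (w , Xw , w≢v , w≢x , few) none
      ... | yes (i , j , i≢j , li , lj) = ≤-trans (+-mono-≤ (linked-covered li) (linked-covered lj))
              (≤-trans (two-terms≤sum (λ k → coverage (mate (A k)) w) i≢j) (m≤m+n _ _))
    -- `y` is linked to `x` only in the colour of `xy`; the extra matching `B` in that colour misses
    -- `y` and therefore covers `x`.
    ... | yes (y , Xy , y≢v , y≢x , few) = i₀ , weight≤ Xx x≢v A A-max Ax y B
            (weight-pointwise Xx x≢v A A-max Ax y B at-x (λ _ → adjacent-total Xx x≢v A A-max Ax Xy Axy) twice)
      where
      i₀ = col x y
      Axy : Adj x y
      Axy = complete (y≢x ∘ sym) x≢v y≢v
      choice : ∀ i → Σ[ M ∈ Matching (Edge X i) ]
        (m i + m i ≤ order (mate M) × mate M x ≡ x × (i ≢ i₀ → mate M y ≡ y))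
      choice i with i ≟ i₀
      ... | yes refl = let M , M-max , Mx , _ = avoid i Xx in M , M-max , Mx , contradiction refl
      -- The edge `xy` already links its ends in `i₀`, so `few` excludes a link in `i`.
      ... | no i≢i₀ with avoidsBoth? X? i (m i + m i) x y
      ...   | yes (M , M-max , Mx , My) = M , M-max , Mx , λ _ → My
      ...   | no li = contradiction (i , i₀ , i≢i₀ , li , adjacent⇒linked Xx Xy Axy) few
      A : ∀ i → Matching (Edge X i)
      A i = proj₁ (choice i)
      A-max : ∀ i → m i + m i ≤ order (mate (A i))
      A-max i = proj₁ (proj₂ (choice i))
      Ax : ∀ i → mate (A i) x ≡ x
      Ax i = proj₁ (proj₂ (proj₂ (choice i)))
      Ay : ∀ {i} → i ≢ i₀ → mate (A i) y ≡ y
      Ay {i} = proj₂ (proj₂ (proj₂ (choice i)))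
      B : Matching (Edge X i₀)
      B = proj₁ (avoid i₀ Xy)
      B-max : m i₀ + m i₀ ≤ order (mate B)
      B-max = proj₁ (proj₂ (avoid i₀ Xy))
      By : mate B y ≡ y
      By = proj₁ (proj₂ (proj₂ (avoid i₀ Xy)))
      y-covers : ∀ {i w} (M : Matching (Edge X i)) → m i + m i ≤ order (mate M) → mate M y ≡ y →
        X w → Adj y w → col y w ≡ i → 1 ≤ coverage (mate M) w
      y-covers M M-max My Xw a eq = ≤-reflexive (sym (covered (mate M)
        (maximum-covers Edge-sym (bound _) M M-max My (Adj⇒≢ a) (Xy , Xw , a , eq))))
      at-x : 1 ≤ coverage (mate B) x + ind (x ≟ y)
      at-x = ≤-trans (y-covers B B-max By Xx (Adj-sym Axy) (col-sym y x)) (m≤m+n _ _)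
      twice : ∀ {w} → X w → w ≢ v → w ≢ x → w ≢ y →
        2 ≤ total Xx x≢v A A-max Ax w + coverage (mate B) w
      -- A maximum matching that misses `y` in the colour of `yw` covers `w`: it is `B` if that
      -- colour is `i₀`, and `A (col y w)` otherwise. The second cover comes from `A (col x w)`,
      -- unless this is the same matching.
      twice {w} Xw w≢v w≢x w≢y with col y w ≟ i₀ | col x w ≟ col y w
      ... | yes eq | _ = +-mono-≤ (adjacent-total Xx x≢v A A-max Ax Xw xw) (y-covers B B-max By Xw yw eq)
        where
        xw = complete (w≢x ∘ sym) x≢v w≢v
        yw = complete (w≢y ∘ sym) y≢v w≢v
      ... | no j≢i₀ | no i≢j = ≤-trans (+-mono-≤
              (adjacent-covered Xx x≢v A A-max Ax Xw (complete (w≢x ∘ sym) x≢v w≢v))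
              (y-covers (A (col y w)) (A-max _) (Ay j≢i₀) Xw (complete (w≢y ∘ sym) y≢v w≢v) refl))
              (≤-trans (two-terms≤sum (λ k → coverage (mate (A k)) w) i≢j) (m≤m+n _ _))
      -- Here `A j` misses both `x` and `y`, which are neighbours of `w` in colour `j`; Gallai's
      -- lemma forbids this, as `N` misses `w`.
      ... | no j≢i₀ | yes i≡j = contradiction Nw
              (neighbours-not-both-missed Edge-sym (bound j) _ (A j) N (n<1+n _) (A-max j) N-max
                (Xw , Xx , complete w≢x w≢v x≢v , trans (col-sym w x) i≡j)
                (Xw , Xy , complete w≢y w≢v y≢v , col-sym w y)
                w≢x w≢y (y≢x ∘ sym) (Ax j) (Ay j≢i₀))
        where
        j = col y w
        N = proj₁ (avoid j Xw)
        N-max = proj₁ (proj₂ (avoid j Xw))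
        Nw = proj₁ (proj₂ (proj₂ (avoid j Xw)))

    -- The counting contradiction and the deletion of essential vertices

    module _ {b : ℕ} (m≤b : ∀ i → m i ≤ b) (large : 2 + b + sum m ≤ sum (λ u → ind (X? u)))
      (nonneighbours : sum (λ u → ind (¬? (Adj? u v))) ≤ 1 + b + b) where

      private
        others = sum (λ u → ind (Other? u))

      -- `weight-bound` regrouped so that the right side is a double. Halving gives `few-others`,
      -- and the odd unit gives the strict `fewer-others`.
      others-bound : ∀ {x} → X x → x ≢ v →
        ∃[ i ] others + others + ind (Joined? x v) ≤ (1 + m i + sum m) + (1 + m i + sum m)
      others-bound {x} Xx x≢v with weight-bound Xx x≢v
      ... | i , le = i , (begin
        others + others + ind (Joined? x v)
          ≤⟨ +-monoʳ-≤ (others + others) (term≤sum (λ w → ind (Joined? x w)) v) ⟩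
        others + others + sum (λ w → ind (Joined? x w))
          ≡⟨ cong (_+ sum (λ w → ind (Joined? x w))) (∑-distrib-+ (λ w → ind (Other? w)) (λ w → ind (Other? w))) ⟨
        sum (λ w → ind (Other? w) + ind (Other? w)) + sum (λ w → ind (Joined? x w))
          ≡⟨ ∑-distrib-+ (λ w → ind (Other? w) + ind (Other? w)) (λ w → ind (Joined? x w)) ⟨
        sum (weight x) ≤⟨ le ⟩
        sum m + sum m + (m i + m i) + 1 + 1 ≡⟨ rearrange (sum m) (m i) ⟩
        (1 + m i + sum m) + (1 + m i + sum m) ∎)
        where
        open ≤-Reasoning
        rearrange : ∀ t p → t + t + (p + p) + 1 + 1 ≡ (1 + p + t) + (1 + p + t)
        rearrange = solve-∀

      few-others : ∀ {x} → X x → x ≢ v → ∃[ i ] others ≤ 1 + m i + sum m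
      few-others Xx x≢v = map₂ halve (others-bound Xx x≢v)
        where
        halve : ∀ {a e d} → a + a + e ≤ d + d → a ≤ d
        halve {a} {e} {d} le = ≮⇒≥ {d} {a} λ lt → <⇒≱ (+-mono-< lt lt) (≤-trans (m≤m+n (a + a) e) le)

      fewer-others : ∀ {x} → X x → x ≢ v → X v → Adj x v → ∃[ i ] others < 1 + m i + sum m
      fewer-others {x} Xx x≢v Xv a = map₂ (halve (ind-yes (Joined? x v) (refl , Xv , a))) (others-bound Xx x≢v)
        where
        halve : ∀ {a e d} → e ≡ 1 → a + a + e ≤ d + d → a < d
        halve {a} {_} {d} refl le = doubled-< {a} {d} (≤-trans (≤-reflexive (+-comm 1 (a + a))) le)

      others>0⇒∃ : 0 < others → ∃ Other
      others>0⇒∃ pos = let g , _ , Pg = enumerate {m = 1} Other? pos in g zero , Pg zero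

      impossible : ⊥
      impossible with X? v
      -- Without `v`, all of `X` counts towards `others`, which `few-others` already forbids.
      ... | no ¬Xv = let x , Xx , x≢v = others>0⇒∃ (≤-trans (s≤s z≤n) many)
                         i , le = few-others Xx x≢v
                     in <⇒≱ (s≤s (s≤s (+-monoˡ-≤ (sum m) (m≤b i)))) (≤-trans many le)
        where
        many : 2 + b + sum m ≤ others
        many = ≤-trans large (sum-mono λ u → ind-mono (X? u) (Other? u) λ Xu → Xu , λ { refl → ¬Xv Xu })
      ... | yes Xv = by-neighbour (any? λ x → X? x ×-dec (¬? (x ≟ v) ×-dec Adj? x v))
        where
        open ≤-Reasoning
        pointwise : ∀ u → ind (X? u) ≤ ind (Other? u) + ind (u ≟ v)
        pointwise u with u ≟ v
        ... | yes _ = ≤-trans (ind≤1 (X? u)) (m≤n+m 1 _)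
        ... | no u≢v with X? u
        ...   | yes _ = s≤s z≤n
        ...   | no _ = z≤n
        -- Leaving out `v` costs one. Now `few-others` alone is no contradiction; a neighbour of `v`
        -- must make it strict, unless `v` is isolated in `X`.
        many : 1 + b + sum m ≤ others
        many = +-cancelʳ-≤ 1 _ _ (begin
          1 + b + sum m + 1 ≡⟨ +-comm _ 1 ⟩
          2 + b + sum m ≤⟨ large ⟩
          sum (λ u → ind (X? u)) ≤⟨ sum-mono pointwise ⟩
          sum (λ u → ind (Other? u) + ind (u ≟ v)) ≡⟨ sum-+-point (λ u → ind (Other? u)) v ⟩
          others + 1 ∎)
        by-neighbour : Dec (∃ λ x → X x × x ≢ v × Adj x v) → ⊥
        by-neighbour (yes (x , Xx , x≢v , a)) =
          let i , lt = fewer-others Xx x≢v Xv a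
          in <⇒≱ lt (≤-trans (s≤s (+-monoˡ-≤ (sum m) (m≤b i))) many)
        -- All of `X` is non-adjacent to `v`, so `large` gives `sum m < b`, whereas `few-others`
        -- gives `b ≤ m i`.
        by-neighbour (no isolated) =
          let x , Xx , x≢v = others>0⇒∃ (≤-trans (s≤s z≤n) many)
              i , le = few-others Xx x≢v
          in <⇒≱ (≤-<-trans (term≤sum m i) sum<b)
               (+-cancelʳ-≤ (sum m) _ _ (s≤s⁻¹ (≤-trans many le)))
          where
          sum<b : sum m < b
          sum<b = +-cancelˡ-≤ (1 + b) _ _ (begin
            1 + b + suc (sum m) ≡⟨ +-suc (1 + b) (sum m) ⟩
            2 + b + sum m ≤⟨ large ⟩
            sum (λ u → ind (X? u)) ≤⟨ sum-mono (λ u → ind-mono (X? u) (¬? (Adj? u v))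
              λ Xu a → isolated (u , Xu , Adj⇒≢ a , a)) ⟩
            sum (λ u → ind (¬? (Adj? u v))) ≤⟨ nonneighbours ⟩
            1 + b + b ∎)

  -- Induction on a bound `k` for the number of surviving vertices. Deleting an essential vertex
  -- lowers both sides of the size hypothesis by one, while `b` stays fixed.
  some-large-matching : ∀ {b} → sum (λ u → ind (¬? (Adj? u v))) ≤ 1 + b + b →
    ∀ k {X : Fin V → Set} (X? : Decidable X) (m : Fin c → ℕ) →
    sum (λ u → ind (X? u)) ≤ k → (∀ i → m i ≤ b) → 2 + b + sum m ≤ sum (λ u → ind (X? u)) →
    ¬ (∀ i (M : Matching (Edge X i)) → order (mate M) ≤ m i + m i)
  some-large-matching nonneighbours zero X? m X≤k m≤b large bound = <⇒≱ (≤-trans (s≤s z≤n) large) X≤k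
  some-large-matching {b} nonneighbours (suc k) {X} X? m X≤k m≤b large bound
    with any? (λ i → any? λ x → X? x ×-dec ¬? (avoidsBoth? X? i (m i + m i) x x))
  ... | no none = NoEssentialVertex.impossible X X? m bound
          (λ i {x} Xx → decidable-stable (avoidsBoth? X? i (m i + m i) x x) λ ne → none (i , x , Xx , ne))
          m≤b large nonneighbours
  ... | yes (i , x , Xx , essential) =
          some-large-matching nonneighbours k X′? m′ X′≤k m′≤b large′ bound′
    where
    X′ : Fin V → Set
    X′ u = X u × u ≢ x
    X′? : Decidable X′
    X′? u = X? u ×-dec ¬? (u ≟ x)
    m′ : Fin c → ℕ
    m′ j = m j ∸ ind (j ≟ i)
    -- If `m i` were zero, the empty matching would avoid `x`. Hence the truncated subtraction in
    -- `m′` is exact.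
    m-positive : 1 ≤ m i
    m-positive with m i
    ... | zero = contradiction (emptyMatching , z≤n , refl , refl) essential
    ... | suc _ = s≤s z≤n
    ind≤m : ∀ j → ind (j ≟ i) ≤ m j
    ind≤m j with j ≟ i
    ... | yes refl = m-positive
    ... | no _ = z≤n
    sum-m : sum m′ + 1 ≡ sum m
    sum-m = trans (sym (sum-+-point m′ i)) (sum-cong-≗ λ j → m∸n+n≡m (ind≤m j))
    sum-X : sum (λ u → ind (X′? u)) + 1 ≡ sum (λ u → ind (X? u))
    sum-X = trans (sym (sum-+-point (λ u → ind (X′? u)) x)) (sum-cong-≗ pointwise)
      where
      pointwise : ∀ u → ind (X′? u) + ind (u ≟ x) ≡ ind (X? u)
      pointwise u with u ≟ x | X? u
      ... | yes refl | yes _ = refl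
      ... | yes refl | no ¬Xu = contradiction Xx ¬Xu
      ... | no _ | yes _ = refl
      ... | no _ | no _ = refl
    X′≤k : sum (λ u → ind (X′? u)) ≤ k
    X′≤k = +-cancelʳ-≤ 1 _ _ (≤-trans (≤-reflexive sum-X) (≤-trans X≤k (≤-reflexive (+-comm 1 k))))
    m′≤b : ∀ j → m′ j ≤ b
    m′≤b j = ≤-trans (m∸n≤m (m j) (ind (j ≟ i))) (m≤b j)
    large′ : 2 + b + sum m′ ≤ sum (λ u → ind (X′? u))
    large′ = +-cancelʳ-≤ 1 _ _ (≤-trans (≤-reflexive (trans (+-assoc (2 + b) (sum m′) 1) (cong (2 + b +_) sum-m)))
      (≤-trans large (≤-reflexive (sym sum-X))))
    widen : ∀ {j u w} → Edge X′ j u w → Edge X j u w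
    widen ((Xu , _) , (Xw , _) , rest) = Xu , Xw , rest
    bound′ : ∀ j (M : Matching (Edge X′ j)) → order (mate M) ≤ m′ j + m′ j
    bound′ j M with j ≟ i
    ... | no _ = bound j (mapMatching widen M)
    -- A matching inside `X′` misses the essential `x`, so it falls short of `m i + m i`, and by
    -- parity it has at least one edge fewer.
    ... | yes refl = order<⇒order≤ {m = m i} M (≰⇒> λ le → essential (mapMatching widen M , le , Mx , Mx))
      where
      Mx : mate M x ≡ x
      Mx = decidable-stable (mate M x ≟ x) λ ne → proj₂ (proj₁ (mate-edge M x ne)) refl

-- Transfer to the graphs and matchings of the statement

edges-of-matching : ∀ {M k c i m} {col : Coloring c M} (N : Matching (λ u w → Adj M k u w × col u w ≡ i)) →
  m + m ≤ order (mate N) → MonoMatching M k col i m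
edges-of-matching {M} {k} {i = i} {m} {col} N m≤N = record
  { edge     = λ p → g p , mate N (g p)
  ; isEdge   = λ p → proj₁ (isEdge p)
  ; colour   = λ p → proj₂ (isEdge p)
  ; disjoint = λ p q p≢q → p≢q ∘ g-injective p q , crossing p q , (λ eq → crossing q p (sym eq)) ,
      λ eq → p≢q (g-injective p q (trans (sym (involutive N _)) (trans (cong (mate N) eq) (involutive N _))))
  }
  where
  m≤edges : m ≤ edgeCount (mate N)
  m≤edges = ≮⇒≥ λ lt → <⇒≱ (+-mono-< lt lt)
    (≤-trans m≤N (≤-reflexive (order≡edgeCount+edgeCount (mate N) (involutive N))))
  enumeration = enumerate (λ u → u F.<? mate N u) m≤edges
  g = proj₁ enumeration
  g-injective = proj₁ (proj₂ enumeration)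
  g< = proj₂ (proj₂ enumeration)
  isEdge : ∀ p → Adj M k (g p) (mate N (g p)) × col (g p) (mate N (g p)) ≡ i
  isEdge p = mate-edge N (g p) λ eq → F.<-irrefl (sym eq) (g< p)
  -- Edges are listed from their smaller ends. If `g p` were the larger end of edge `q`, then `g p`
  -- and `g q` would be partners, each smaller than the other.
  crossing : ∀ p q → g p ≢ mate N (g q)
  crossing p q eq = F.<-asym (subst (g p F.<_) eq′ (g< p)) (subst (g q F.<_) (sym eq) (g< q))
    where
    eq′ : mate N (g p) ≡ g q
    eq′ = trans (cong (mate N) eq) (involutive N (g q))

list-sum≡sum : ∀ {d} (f : Fin d → ℕ) → ListAction.sum (List.map f (List.allFin d)) ≡ sum f
list-sum≡sum {d} f = trans (cong ListAction.sum (map-tabulate (λ i → i) f)) (sum-tabulate f)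
  where
  sum-tabulate : ∀ {d} (f : Fin d → ℕ) → ListAction.sum (List.tabulate f) ≡ sum f
  sum-tabulate {zero} f = refl
  sum-tabulate {suc d} f = cong (f zero +_) (sum-tabulate (f ∘ suc))

count-≮ : ∀ M k → sum {M} (λ a → ind (¬? (toℕ a ℕ.<? k))) ≤ M ∸ k
count-≮ zero k = z≤n
count-≮ (suc M) zero = s≤s (count-≮ M zero)
count-≮ (suc M) (suc k) = count-≮ M k

count-⊤ : ∀ k → sum {k} (λ _ → 1) ≡ k
count-⊤ zero = refl
count-⊤ (suc k) = cong suc (count-⊤ k)

Adj? : ∀ M k u w → Dec (Adj M k u w)
Adj? M k zero zero = no λ ne → ne refl
Adj? M k zero (suc b) = toℕ b ℕ.<? k
Adj? M k (suc a) zero = toℕ a ℕ.<? k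
Adj? M k (suc a) (suc b) = ¬? (a ≟ b)

Adj-sym : ∀ {M k} u w → Adj M k u w → Adj M k w u
Adj-sym zero zero a = a
Adj-sym zero (suc _) a = a
Adj-sym (suc _) zero a = a
Adj-sym (suc _) (suc _) a = a ∘ sym

Adj⇒≢ : ∀ {M k} u w → Adj M k u w → u ≢ w
Adj⇒≢ zero zero a refl = a refl
Adj⇒≢ (suc _) (suc _) a refl = a refl

Adj-complete : ∀ {M k} u w → u ≢ w → u ≢ zero → w ≢ zero → Adj M k u w
Adj-complete zero w _ u≢0 _ = contradiction refl u≢0
Adj-complete (suc _) zero _ _ w≢0 = contradiction refl w≢0
Adj-complete (suc a) (suc b) u≢w _ _ = u≢w ∘ cong suc

upper-bound : ∀ {d} (n : Fin (suc d) → ℕ) → (∀ i j → i F.≤ j → n j ≤ n i) → (∀ i → 1 ≤ n i) →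
  Arrows n (tailSum n + 1)
upper-bound {d} n decreasing n≥1 col col-sym
  with any? (λ i → anyMatching? {P = λ f → n i + n i ≤ order f}
    (λ u w → Adj? (Nm1 n) (tailSum n + 1) u w ×-dec (col u w ≟ i))
    (λ f≗g le → ≤-trans le (≤-reflexive (order-cong f≗g))) λ f → n i + n i ℕ.≤? order f)
... | yes (i , N , le) = i , edges-of-matching N le
... | no none = ⊥-elim (some-large-matching nonneighbours _ {λ _ → ⊤} (λ _ → yes tt) m ≤-refl m≤b large bound)
  where
  t = tailSum n
  b = n zero ∸ 1
  m : Fin (suc d) → ℕ
  m i = n i ∸ 1
  open AlmostComplete (Adj (Nm1 n) (t + 1)) (Adj? _ _) (λ {u} {w} → Adj-sym u w) (λ {u} {w} → Adj⇒≢ u w)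
    zero (λ {u} {w} → Adj-complete u w) col col-sym
  n₀≡1+b : n zero ≡ 1 + b
  n₀≡1+b = sym (m+[n∸m]≡n (n≥1 zero))
  nonneighbours : sum (λ u → ind (¬? (Adj? (Nm1 n) (t + 1) u zero))) ≤ 1 + b + b
  -- `s≤s` accounts for `v` itself; among the remaining vertices all but `t + 1` are non-neighbours.
  nonneighbours = s≤s (≤-trans (count-≮ (Nm1 n) (t + 1)) (≤-reflexive (begin
    n zero + (b + t) ∸ (t + 1)  ≡⟨ cong (λ n₀ → n₀ + (b + t) ∸ (t + 1)) n₀≡1+b ⟩
    1 + b + (b + t) ∸ (t + 1)   ≡⟨ cong (_∸ (t + 1)) (rearrange b t) ⟩
    b + b + (t + 1) ∸ (t + 1)   ≡⟨ m+n∸n≡m (b + b) (t + 1) ⟩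
    b + b                       ∎)))
    where
    open ≡-Reasoning
    rearrange : ∀ b t → 1 + b + (b + t) ≡ b + b + (t + 1)
    rearrange = solve-∀
  m≤b : ∀ i → m i ≤ b
  m≤b i = ∸-monoˡ-≤ 1 (decreasing zero i z≤n)
  -- Before any deletion this is an equality.
  large : 2 + b + sum m ≤ sum {suc (Nm1 n)} (λ _ → 1)
  large = ≤-reflexive (begin
    2 + b + (b + sum (m ∘ suc))  ≡⟨ cong (λ s → 2 + b + (b + s)) (list-sum≡sum (m ∘ suc)) ⟨
    2 + b + (b + t)              ≡⟨ cong (λ n₀ → 1 + n₀ + (b + t)) n₀≡1+b ⟨
    suc (Nm1 n)                  ≡⟨ count-⊤ (suc (Nm1 n)) ⟨
    sum {suc (Nm1 n)} (λ _ → 1)  ∎)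
    where open ≡-Reasoning
  bound : ∀ i (N : Matching (Edge (λ _ → ⊤) i)) → order (mate N) ≤ m i + m i
  bound i N = order<⇒order≤ {m = n i} N (≰⇒> λ le → none (i , mapMatching (proj₂ ∘ proj₂) N , le))

-- Lower bound: the extremal colouring

-- ℕ is cut into consecutive blocks of sizes s 0, s 1, …; inj₂ r is the r-th number after all blocks.
Cell : ∀ {d} → (Fin d → ℕ) → Set
Cell {d} s = (Σ[ j ∈ Fin d ] Fin (s j)) ⊎ ℕ

locate : ∀ {d} (s : Fin d → ℕ) → ℕ → Cell s
locate {zero} s a = inj₂ a
locate {suc d} s a with a ℕ.<? s zero
... | yes a<s = inj₁ (zero , fromℕ< a<s)
... | no _ = map₁ (λ (j , p) → suc j , p) (locate (s ∘ suc) (a ∸ s zero))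

index : ∀ {d} (s : Fin d → ℕ) → Cell s → ℕ
index s (inj₂ r) = sum s + r
index s (inj₁ (zero , p)) = toℕ p
index s (inj₁ (suc j , p)) = s zero + index (s ∘ suc) (inj₁ (j , p))

-- A number can be recovered from its cell, so distinct vertices of one block occupy distinct slots.
index-locate : ∀ {d} (s : Fin d → ℕ) a → index s (locate s a) ≡ a
index-locate {zero} s a = refl
index-locate {suc d} s a with a ℕ.<? s zero
... | yes a<s = toℕ-fromℕ< a<s
... | no a≮s = trans (shifted (locate (s ∘ suc) (a ∸ s zero)))
    (trans (cong (s zero +_) (index-locate (s ∘ suc) (a ∸ s zero))) (m+[n∸m]≡n (≮⇒≥ a≮s)))
  where
  shifted : ∀ x → index s (map₁ (λ (j , p) → suc j , p) x) ≡ s zero + index (s ∘ suc) x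
  shifted (inj₁ _) = refl
  shifted (inj₂ r) = +-assoc (s zero) _ r

module Extremal {d} (n : Fin (suc d) → ℕ) (n≥1 : ∀ i → 1 ≤ n i) where

  open import Algebra.Construct.NaturalChoice.Max (F.≤-totalOrder (suc d)) using (_⊔_; ⊔-sel; ⊔-comm; x≤x⊔y; x≤y⊔x)

  block : Fin d → ℕ
  block j = n (suc j) ∸ 1

  tailSum≡ : tailSum n ≡ sum block
  tailSum≡ = list-sum≡sum block

  -- The blocks take the numbers below `tailSum n`, so they contain every neighbour of `v` as long
  -- as `k ≤ tailSum n`.
  class : Fin (suc (Nm1 n)) → Fin (suc d)
  class zero = zero
  class (suc a) = [ (λ (j , _) → suc j) , (λ _ → zero) ]′ (locate block (toℕ a))

  colouring : Coloring (suc d) (Nm1 n)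
  colouring u w = class u ⊔ class w

  colouring-symmetric : Symmetric colouring
  colouring-symmetric u w = ⊔-comm (class u) (class w)

  in-block : ∀ {j} u → class u ≡ suc j → ∃[ p ] ∃[ a ] u ≡ suc a × toℕ a ≡ index block (inj₁ (j , p))
  in-block (suc a) eq with locate block (toℕ a) | index-locate block (toℕ a)
  in-block (suc a) refl | inj₁ (j , p) | pos = p , a , refl , sym pos

  outside-blocks : ∀ a → class (suc a) ≡ zero → ∃[ r ] toℕ a ≡ tailSum n + r
  outside-blocks a eq with locate block (toℕ a) | index-locate block (toℕ a)
  ... | inj₂ r | pos = r , trans (sym pos) (cong (_+ r) (sym tailSum≡))

  module _ {k} (k≤t : k ≤ tailSum n) where

    -- An edge at `v` leads into a block, so an edge within class `zero` avoids `v` and has its ends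
    -- among the vertices numbered after the blocks.
    core-index : ∀ u w → Adj (Nm1 n) k u w → class u ≡ zero → class w ≡ zero →
      Σ[ r ∈ Fin (n zero + (n zero ∸ 1)) ] ∃[ a ] u ≡ suc a × toℕ a ≡ tailSum n + toℕ r
    core-index zero zero adj _ _ = contradiction refl adj
    core-index zero (suc b) b<k _ eq with outside-blocks b eq
    ... | r , pos = contradiction (≤-trans b<k k≤t) (≤⇒≯ (≤-trans (m≤m+n _ r) (≤-reflexive (sym pos))))
    core-index (suc a) w _ eq _ with outside-blocks a eq
    ... | r , pos = fromℕ< r< , a , refl , trans pos (cong (tailSum n +_) (sym (toℕ-fromℕ< r<)))
      where
      open ≤-Reasoning
      r< : r < n zero + (n zero ∸ 1)
      r< = +-cancelˡ-< (tailSum n) _ _ (begin-strict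
        tailSum n + r                          ≡⟨ pos ⟨
        toℕ a                                  <⟨ F.toℕ<n a ⟩
        n zero + ((n zero ∸ 1) + tailSum n)    ≡⟨ +-assoc (n zero) _ (tailSum n) ⟨
        n zero + (n zero ∸ 1) + tailSum n      ≡⟨ +-comm (n zero + (n zero ∸ 1)) (tailSum n) ⟩
        tailSum n + (n zero + (n zero ∸ 1))    ∎)

    -- Pigeonhole. In colour `suc j` each edge has an end in block `j`, as a maximum of two classes
    -- is one of them, and the block is one vertex too small. In colour `zero` both ends of every
    -- edge have class `zero`, and twice `n zero` ends do not fit into the places of `core-index`.
    no-matching : ∀ i → ¬ MonoMatching (Nm1 n) k colouring i (n i)
    no-matching (suc j) N = <⇒≱ (∸-monoʳ-< {n (suc j)} {1} {0} (s≤s z≤n) (n≥1 (suc j))) (injective⇒≤ slot-injective)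
      where
      open MonoMatching N
      end : ∀ p → Σ[ u ∈ _ ] (u ≡ proj₁ (edge p) ⊎ u ≡ proj₂ (edge p)) × class u ≡ suc j
      end p with ⊔-sel (class (proj₁ (edge p))) (class (proj₂ (edge p)))
      ... | inj₁ eq = _ , inj₁ refl , trans (sym eq) (colour p)
      ... | inj₂ eq = _ , inj₂ refl , trans (sym eq) (colour p)
      end-injective : ∀ {p q} → proj₁ (end p) ≡ proj₁ (end q) → p ≡ q
      end-injective {p} {q} eq = decidable-stable (p ≟ q) λ p≢q →
        clash (disjoint p q p≢q) (proj₁ (proj₂ (end p))) (proj₁ (proj₂ (end q))) eq
        where
        clash : ∀ {x₁ x₂ y₁ y₂ u w : Fin (suc (Nm1 n))} → (x₁ ≢ y₁) × (x₁ ≢ y₂) × (x₂ ≢ y₁) × (x₂ ≢ y₂) →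
          u ≡ x₁ ⊎ u ≡ x₂ → w ≡ y₁ ⊎ w ≡ y₂ → u ≢ w
        clash (a , _ , _ , _) (inj₁ refl) (inj₁ refl) = a
        clash (_ , a , _ , _) (inj₁ refl) (inj₂ refl) = a
        clash (_ , _ , a , _) (inj₂ refl) (inj₁ refl) = a
        clash (_ , _ , _ , a) (inj₂ refl) (inj₂ refl) = a
      slotted = λ p → in-block (proj₁ (end p)) (proj₂ (proj₂ (end p)))
      slot : Fin (n (suc j)) → Fin (block j)
      slot p = proj₁ (slotted p)
      slot-injective : ∀ {p q} → slot p ≡ slot q → p ≡ q
      slot-injective {p} {q} eq with slotted p | slotted q
      ... | _ , a , u≡a , pos | _ , b , w≡b , pos′ = end-injective (trans u≡a (trans (cong suc (F.toℕ-injective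
              (trans pos (trans (cong (λ r → index block (inj₁ (j , r))) eq) (sym pos′))))) (sym w≡b)))
    no-matching zero N = <⇒≱ (+-monoʳ-< (n zero) (∸-monoʳ-< {n zero} {1} {0} (s≤s z≤n) (n≥1 zero)))
        (injective⇒≤ (splitAt-injective ∘ slot-injective))
      where
      open MonoMatching N
      Side = Fin (n zero) ⊎ Fin (n zero)
      end : Side → Fin (suc (Nm1 n))
      end (inj₁ p) = proj₁ (edge p)
      end (inj₂ p) = proj₂ (edge p)
      end-injective : ∀ x y → end x ≡ end y → x ≡ y
      end-injective (inj₁ p) (inj₁ q) eq = cong inj₁ (decidable-stable (p ≟ q) λ p≢q → proj₁ (disjoint p q p≢q) eq)
      end-injective (inj₂ p) (inj₂ q) eq =
        cong inj₂ (decidable-stable (p ≟ q) λ p≢q → proj₂ (proj₂ (proj₂ (disjoint p q p≢q))) eq)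
      end-injective (inj₁ p) (inj₂ q) eq with p ≟ q
      ... | yes refl = contradiction eq (Adj⇒≢ _ _ (isEdge p))
      ... | no p≢q = contradiction eq (proj₁ (proj₂ (disjoint p q p≢q)))
      end-injective (inj₂ p) (inj₁ q) eq with p ≟ q
      ... | yes refl = contradiction (sym eq) (Adj⇒≢ _ _ (isEdge p))
      ... | no p≢q = contradiction eq (proj₁ (proj₂ (proj₂ (disjoint p q p≢q))))
      ≤zero : ∀ {x y : Fin (suc d)} → x F.≤ y → y ≡ zero → x ≡ zero
      ≤zero x≤0 refl = F.toℕ-injective (n≤0⇒n≡0 x≤0)
      class₁ : ∀ p → class (proj₁ (edge p)) ≡ zero
      class₁ p = ≤zero (x≤x⊔y _ (class (proj₂ (edge p)))) (colour p)
      class₂ : ∀ p → class (proj₂ (edge p)) ≡ zero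
      class₂ p = ≤zero (x≤y⊔x (class (proj₁ (edge p))) _) (colour p)
      slotted : ∀ x → Σ[ r ∈ Fin (n zero + (n zero ∸ 1)) ] ∃[ a ] end x ≡ suc a × toℕ a ≡ tailSum n + toℕ r
      slotted (inj₁ p) = core-index _ _ (isEdge p) (class₁ p) (class₂ p)
      slotted (inj₂ p) = core-index _ _ (Adj-sym _ _ (isEdge p)) (class₂ p) (class₁ p)
      slot-injective : ∀ {x y} → proj₁ (slotted x) ≡ proj₁ (slotted y) → x ≡ y
      slot-injective {x} {y} eq with slotted x | slotted y
      ... | _ , a , u≡a , pos | _ , b , w≡b , pos′ = end-injective x y (trans u≡a (trans (cong suc (F.toℕ-injective
              (trans pos (trans (cong (λ r → tailSum n + toℕ r) eq) (sym pos′))))) (sym w≡b)))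
      splitAt-injective : ∀ {x y} → splitAt (n zero) {n zero} x ≡ splitAt (n zero) y → x ≡ y
      splitAt-injective {x} {y} eq = trans (sym (F.join-splitAt (n zero) (n zero) x))
        (trans (cong (join (n zero) (n zero)) eq) (F.join-splitAt (n zero) (n zero) y))

theorem2 : (d : ℕ) (n : Fin (suc d) → ℕ) →
    (∀ i j → i F.≤ j → n j ≤ n i) →
    (∀ i → 1 ≤ n i) →
    IsStarCritical n (tailSum n + 1)
theorem2 d n decreasing n≥1 =
  m≤n+m 1 (tailSum n) ,
  upper-bound n decreasing n≥1 ,
  λ k _ k<s arrows → let i , N = arrows colouring colouring-symmetric
                     in no-matching (s≤s⁻¹ (subst (k <_) (+-comm (tailSum n) 1) k<s)) i N
  where open Extremal n n≥1
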